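{- The operation $f\mapsto f^{\mathcal D}$ is an interior operator on the (strong) Weihrauch lattice. That is, for all problems $f,g$: (1) $f^{\mathcal D}\leq_{\mathrm{sW}}f$; (2) $f\leq_{\mathrm{sW}}g$ implies $f^{\mathcal D}\leq_{\mathrm{sW}}g^{\mathcal D}$; (3) $f^{\mathcal D}\leq_{\mathrm{sW}}f^{\mathcal D\mathcal D}$, where $f^{\mathcal D\mathcal D}=(f^{\mathcal D})^{\mathcal D}$. Analogous statements hold with $\leq_{\mathrm{sW}}$ replaced throughout by any of $\leq_{\mathrm W}$, $\leq_{\mathrm W}^*$, $\leq_{\mathrm{sW}}^*$.
   Context: A represented space is a set $X$ with a partial surjective map $\delta_X:\subseteq\mathbb N^{\mathbb N}\to X$. A problem is a partial multi-valued function $f:\subseteq X\rightrightarrows Y$ between represented spaces that has a realizer; a realizer of $f$ is a function $F:\subseteq\mathbb N^{\mathbb N}\to\mathbb N^{\mathbb N}$ with $\delta_YF(p)\in f\delta_X(p)$ for all $p\in\mathrm{dom}(f\delta_X)$. For $p,q\in\mathbb N^{\mathbb N}$, $\langle p,q\rangle(2n)=p(n)$, $\langle p,q\rangle(2n+1)=q(n)$. For problems $f,g$: $f\leq_{\mathrm W}g$ if there are computable $H,K:\subseteq\mathbb N^{\mathbb N}\to\mathbb N^{\mathbb N}$ such that $H\langle\mathrm{id},GK\rangle$ is a realizer of $f$ whenever $G$ is a realizer of $g$; $f\leq_{\mathrm{sW}}g$ is defined likewise with $HGK$ instead of $H\langle\mathrm{id},GK\rangle$. $\leq_{\mathrm W}^*$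 and $\leq_{\mathrm{sW}}^*$ are defined likewise with continuous instead of computable $H,K$. $\mathcal D$ is the set of Turing degrees $\deg_{\mathrm T}(p)=\{q\in\mathbb N^{\mathbb N}:q\equiv_{\mathrm T}p\}$, represented by $\delta_{\mathcal D}:\mathbb N^{\mathbb N}\to\mathcal D$, $p\mapsto\deg_{\mathrm T}(p)$. For $y$ in a represented space $(Y,\delta_Y)$ and $q\in\mathbb N^{\mathbb N}$, $y\leq_{\mathrm T}q$ means that some name $p\in\delta_Y^{ -1}\{y\}$ satisfies $p\leq_{\mathrm T}q$. The upper Turing cone version of $f:\subseteq X\rightrightarrows Y$ is $f^{\mathcal D}:\subseteq X\rightrightarrows\mathcal D$ with $\mathrm{dom}(f^{\mathcal D})=\mathrm{dom}(f)$ and $f^{\mathcal D}(x)=\{\deg_{\mathrm T}(q):(\exists y\leq_{\mathrm T}q)\ y\in f(x)\}$. -}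

module Defs where

open import Level using (0ℓ; _⊔_) renaming (suc to lsuc)
open import Data.Fin using (Fin; zero; suc; toℕ)
open import Data.Nat using (ℕ; zero; suc; _+_; _*_; _<_)
open import Data.Nat.Properties using (+-suc)
open import Data.Product using (_×_; _,_; ∃; ∃-syntax; proj₁; proj₂)
open import Data.Vec using (Vec; []; _∷_; lookup)
open import Function using (_∘_; _⇔_; mk⇔)
open import Relation.Binary using (Rel; Setoid)
open import Relation.Binary.PropositionalEquality
  using (_≡_; _≗_; refl; sym; trans; cong; subst)

-- Elements of Baire space are compared by pointwise equality _≗_ throughout.
Baire : Set
Baire = ℕ → ℕ

⟨_,_⟩ : Baire → Baire → Baire
⟨ p , q ⟩ zero    = p zero
⟨ p , q ⟩ (suc n) = ⟨ q , p ∘ suc ⟩ n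

⟨,⟩-even : ∀ p q n → ⟨ p , q ⟩ (2 * n) ≡ p n
⟨,⟩-even p q zero = refl
⟨,⟩-even p q (suc n) rewrite +-suc n (n + 0) = ⟨,⟩-even (p ∘ suc) (q ∘ suc) n

⟨,⟩-odd : ∀ p q n → ⟨ p , q ⟩ (suc (2 * n)) ≡ q n
⟨,⟩-odd p q n = ⟨,⟩-even q (p ∘ suc) n

------------------------------------------------------------------------
-- Oracle computability: Kleene's μ-recursive functions with an extra
-- basic function for the oracle.

data Code : ℕ → Set where
  oracle : Code 1
  zer    : Code 0
  succ   : Code 1
  proj   : ∀ {n} → Fin n → Code n
  comp   : ∀ {m n} → Code m → (Fin m → Code n) → Code n
  prec   : ∀ {n} → Code n → Code (suc (suc n)) → Code (suc n)
  mu     : ∀ {n} → Code (suc n) → Code n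

-- p ⊢ e [ xs ]⇓ y : with oracle p, the program e halts on input xs with
-- output y.  In prec and mu the first argument is the recursion (search)
-- variable; mu requires all values below the first zero to be defined.
data _⊢_[_]⇓_ (p : Baire) : ∀ {n} → Code n → Vec ℕ n → ℕ → Set where
  ⇓oracle : ∀ {x} → p ⊢ oracle [ x ∷ [] ]⇓ p x
  ⇓zer    : p ⊢ zer [ [] ]⇓ 0
  ⇓succ   : ∀ {x} → p ⊢ succ [ x ∷ [] ]⇓ suc x
  ⇓proj   : ∀ {n} {xs : Vec ℕ n} i → p ⊢ proj i [ xs ]⇓ lookup xs i
  ⇓comp   : ∀ {m n} {f : Code m} {gs : Fin m → Code n} {xs z} (ys : Vec ℕ m) →
            (∀ i → p ⊢ gs i [ xs ]⇓ lookup ys i) →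
            p ⊢ f [ ys ]⇓ z →
            p ⊢ comp f gs [ xs ]⇓ z
  ⇓prec0  : ∀ {n} {f : Code n} {g xs y} →
            p ⊢ f [ xs ]⇓ y →
            p ⊢ prec f g [ 0 ∷ xs ]⇓ y
  ⇓precS  : ∀ {n} {f : Code n} {g xs k r y} →
            p ⊢ prec f g [ k ∷ xs ]⇓ r →
            p ⊢ g [ k ∷ r ∷ xs ]⇓ y →
            p ⊢ prec f g [ suc k ∷ xs ]⇓ y
  ⇓mu     : ∀ {n} {f : Code (suc n)} {xs k} (ys : Vec ℕ k) →
            (∀ i → p ⊢ f [ toℕ i ∷ xs ]⇓ suc (lookup ys i)) →
            p ⊢ f [ k ∷ xs ]⇓ 0 →
            p ⊢ mu f [ xs ]⇓ k

Computes : Code 1 → Baire → Baire → Set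
Computes e p q = ∀ n → p ⊢ e [ n ∷ [] ]⇓ q n

infix 4 _≤T_ _≡T_

_≤T_ : Rel Baire 0ℓ
p ≤T q = ∃[ e ] Computes e q p

_≡T_ : Rel Baire 0ℓ
p ≡T q = p ≤T q × q ≤T p

≤T-reflexive : ∀ {p q} → p ≗ q → p ≤T q
≤T-reflexive {p} {q} p≗q =
  oracle , λ n → subst (q ⊢ oracle [ n ∷ [] ]⇓_) (sym (p≗q n)) ⇓oracle

≤T-refl : ∀ {p} → p ≤T p
≤T-refl = ≤T-reflexive λ _ → refl

substOracle : ∀ {n} → Code 1 → Code n → Code n
substOracle d oracle      = d
substOracle d zer         = zer
substOracle d succ        = succ
substOracle d (proj i)    = proj i
substOracle d (comp f gs) = comp (substOracle d f) (λ i → substOracle d (gs i))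
substOracle d (prec f g)  = prec (substOracle d f) (substOracle d g)
substOracle d (mu f)      = mu (substOracle d f)

substOracle-⇓ : ∀ {p q d} → Computes d q p →
                ∀ {n} {e : Code n} {xs y} →
                p ⊢ e [ xs ]⇓ y → q ⊢ substOracle d e [ xs ]⇓ y
substOracle-⇓ c ⇓oracle        = c _
substOracle-⇓ c ⇓zer           = ⇓zer
substOracle-⇓ c ⇓succ          = ⇓succ
substOracle-⇓ c (⇓proj i)      = ⇓proj i
substOracle-⇓ c (⇓comp ys h t) =
  ⇓comp ys (λ i → substOracle-⇓ c (h i)) (substOracle-⇓ c t)
substOracle-⇓ c (⇓prec0 t)     = ⇓prec0 (substOracle-⇓ c t)
substOracle-⇓ c (⇓precS r t)   = ⇓precS (substOracle-⇓ c r) (substOracle-⇓ c t)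
substOracle-⇓ c (⇓mu ys h t)   =
  ⇓mu ys (λ i → substOracle-⇓ c (h i)) (substOracle-⇓ c t)

≤T-trans : ∀ {p q r} → p ≤T q → q ≤T r → p ≤T r
≤T-trans (e , ce) (d , cd) = substOracle d e , λ n → substOracle-⇓ cd (ce n)

------------------------------------------------------------------------
-- Partial functions on Baire space, given by their graphs.

record PartialFun : Set₁ where
  field
    graph      : Baire → Baire → Set
    resp       : ∀ {p p′ q q′} → p ≗ p′ → q ≗ q′ → graph p q → graph p′ q′
    functional : ∀ {p q q′} → graph p q → graph p q′ → q ≗ q′

open PartialFun using (graph)

infixr 9 _∘ₚ_

_∘ₚ_ : PartialFun → PartialFun → PartialFun
F ∘ₚ G = record
  { graph      = λ p r → ∃[ q ] graph G p q × graph F q r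
  ; resp       = λ { p≗ r≗ (q , Gpq , Fqr) →
      q , G.resp p≗ (λ _ → refl) Gpq , F.resp (λ _ → refl) r≗ Fqr }
  ; functional = λ { (q , Gpq , Fqr) (q′ , Gpq′ , Fq′r′) →
      F.functional (F.resp (G.functional Gpq Gpq′) (λ _ → refl) Fqr) Fq′r′ }
  }
  where
  module F = PartialFun F
  module G = PartialFun G

⟨,⟩-cong : ∀ {p p′ q q′} → p ≗ p′ → q ≗ q′ → ⟨ p , q ⟩ ≗ ⟨ p′ , q′ ⟩
⟨,⟩-cong p≗ q≗ zero    = p≗ zero
⟨,⟩-cong p≗ q≗ (suc n) = ⟨,⟩-cong q≗ (p≗ ∘ suc) n

-- The partial function p ↦ ⟨ p , F p ⟩.
⟨id,_⟩ : PartialFun → PartialFun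
⟨id, F ⟩ = record
  { graph      = λ p r → ∃[ q ] graph F p q × r ≗ ⟨ p , q ⟩
  ; resp       = λ { p≗ r≗ (q , Fpq , r≗⟨p,q⟩) →
      q , F.resp p≗ (λ _ → refl) Fpq ,
      λ n → trans (sym (r≗ n)) (trans (r≗⟨p,q⟩ n) (⟨,⟩-cong p≗ (λ _ → refl) n)) }
  ; functional = λ { (q , Fpq , e) (q′ , Fpq′ , e′) n →
      trans (e n) (trans (⟨,⟩-cong (λ _ → refl) (F.functional Fpq Fpq′) n) (sym (e′ n))) }
  }
  where module F = PartialFun F

-- One program works for every p in the domain; nothing is required of it
-- outside the domain.
Computable : PartialFun → Set
Computable F = ∃[ e ] (∀ {p q} → graph F p q → Computes e p q)

Agree : ℕ → Rel Baire 0ℓ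
Agree n p q = ∀ i → i < n → p i ≡ q i

-- Continuity for the product topology, on the domain with its subspace topology.
Continuous : PartialFun → Set
Continuous F = ∀ {p q} → graph F p q → ∀ n →
  ∃[ m ] (∀ {p′ q′} → graph F p′ q′ → Agree m p p′ → Agree n q q′)

------------------------------------------------------------------------

record RepresentedSpace : Set₁ where
  field
    setoid : Setoid 0ℓ 0ℓ
  open Setoid setoid public using (Carrier; _≈_)
  -- δ p x : p is a name of x, i.e. p ∈ dom(δ) and δ(p) = x.
  field
    δ            : Baire → Carrier → Set
    δ-resp       : ∀ {p p′ x x′} → p ≗ p′ → x ≈ x′ → δ p x → δ p′ x′
    δ-functional : ∀ {p x x′} → δ p x → δ p x′ → x ≈ x′
    δ-surjective : ∀ x → ∃[ p ] δ p x

open RepresentedSpace using (Carrier)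

PointBelow : (Y : RepresentedSpace) → Carrier Y → Baire → Set
PointBelow Y y q = ∃[ p ] RepresentedSpace.δ Y p y × p ≤T q

syntax PointBelow Y y q = y ≤T[ Y ] q

-- Partial multi-valued functions as relations: rel x y means y ∈ f(x), and the
-- domain consists of the points with at least one value.
record MultiFun : Set₁ where
  field
    source target : RepresentedSpace
  module S = RepresentedSpace source
  module T = RepresentedSpace target
  field
    rel  : S.Carrier → T.Carrier → Set
    resp : ∀ {x x′ y y′} → x S.≈ x′ → y T.≈ y′ → rel x y → rel x′ y′

  dom : S.Carrier → Set
  dom x = ∃[ y ] rel x y

_Realizes_ : PartialFun → MultiFun → Set
F Realizes f = ∀ {p x} → S.δ p x → dom x →
  ∃[ q ] graph F p q × (∃[ y ] T.δ q y × rel x y)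
  where open MultiFun f

record Problem : Set₁ where
  field
    multiFun    : MultiFun
    hasRealizer : ∃[ F ] F Realizes multiFun
  open MultiFun multiFun public

open Problem using (multiFun)

------------------------------------------------------------------------

Reduction StrongReduction : (PartialFun → Set) → Rel Problem (lsuc 0ℓ)
Reduction C f g = ∃[ H ] ∃[ K ] C H × C K ×
  (∀ G → G Realizes multiFun g → (H ∘ₚ ⟨id, G ∘ₚ K ⟩) Realizes multiFun f)
StrongReduction C f g = ∃[ H ] ∃[ K ] C H × C K ×
  (∀ G → G Realizes multiFun g → (H ∘ₚ G ∘ₚ K) Realizes multiFun f)

infix 4 _≤W_ _≤sW_ _≤W*_ _≤sW*_

_≤W_ _≤sW_ _≤W*_ _≤sW*_ : Rel Problem (lsuc 0ℓ)
_≤W_   = Reduction Computable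
_≤sW_  = StrongReduction Computable
_≤W*_  = Reduction Continuous
_≤sW*_ = StrongReduction Continuous

------------------------------------------------------------------------

-- A degree is given by a representative; equality of degrees is ≡T.
record Degree : Set where
  constructor deg
  field rep : Baire

_≈D_ : Rel Degree 0ℓ
deg p ≈D deg q = p ≡T q

degreeSetoid : Setoid 0ℓ 0ℓ
degreeSetoid = record
  { Carrier       = Degree
  ; _≈_           = _≈D_
  ; isEquivalence = record
    { refl  = ≤T-refl , ≤T-refl
    ; sym   = λ (a , b) → b , a
    ; trans = λ (a , b) (c , d) → ≤T-trans a c , ≤T-trans d b
    }
  }

module ≈D = Setoid degreeSetoid

𝒟 : RepresentedSpace
𝒟 = record
  { setoid       = degreeSetoid
  ; δ            = λ p d → deg p ≈D d
  ; δ-resp       = λ p≗ d≈ e →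
      ≈D.trans (≤T-reflexive (sym ∘ p≗) , ≤T-reflexive p≗) (≈D.trans e d≈)
  ; δ-functional = λ e e′ → ≈D.trans (≈D.sym e) e′
  ; δ-surjective = λ d → Degree.rep d , ≈D.refl {d}
  }

coneMultiFun : MultiFun → MultiFun
coneMultiFun f = record
  { source = source
  ; target = 𝒟
  ; rel    = λ x d → ∃[ q ] d ≈D deg q × (∃[ y ] y ≤T[ target ] q × rel x y)
  ; resp   = λ { x≈ d≈ (q , e , y , y≤q , fxy) →
      q , ≈D.trans (≈D.sym d≈) e , y , y≤q , resp x≈ (Setoid.refl T.setoid) fxy }
  }
  where open MultiFun f

dom-cone : ∀ f x → MultiFun.dom (coneMultiFun f) x ⇔ MultiFun.dom f x
dom-cone f x = mk⇔
  (λ { (_ , _ , _ , y , _ , fxy) → y , fxy })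
  (λ { (y , fxy) → let (p , δpy) = MultiFun.T.δ-surjective f y in
       deg p , p , ≈D.refl {deg p} , y , (p , δpy , ≤T-refl) , fxy })

infixl 30 _ᴰ

-- Any realizer of f also realizes its cone version.
_ᴰ : Problem → Problem
f ᴰ = record
  { multiFun    = coneMultiFun f.multiFun
  ; hasRealizer = let (F , r) = f.hasRealizer in F , λ { δpx (_ , _ , _ , dom-fx) →
      let (q , Fpq , y , δqy , fxy) = r δpx (proj₁ dom-fx , proj₂ (proj₂ dom-fx)) in
      q , Fpq , deg q , ≈D.refl {deg q} ,
      q , ≈D.refl {deg q} , y , (q , δqy , ≤T-refl) , fxy }
  }
  where module f = Problem f

InteriorOperator : ∀ {a ℓ} {A : Set a} → Rel A ℓ → (A → A) → Set (a ⊔ ℓ)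
InteriorOperator _≤_ op =
  (∀ f → op f ≤ f) ×
  (∀ f g → f ≤ g → op f ≤ op g) ×
  (∀ f → op f ≤ op (op f))

{-# OPTIONS --safe #-}
-- A point of the upper cone of f(x) only has to compute a name of some value
-- in f(x), so the realizers of f and of f ᴰ ᴰ already realize f ᴰ.
-- For monotonicity, let H, K witness f ≤ g and let q be the answer of a
-- realizer of g ᴰ to K p.  Some name b ≤T q of a value of g is the answer to
-- K p of a realizer of g, so H b (respectively H ⟨ p , b ⟩) is a name of a value
-- of f.  A computable H can be dropped, as H b ≤T b ≤T q.  A continuous H is
-- computable relative to an oracle c, so it can be replaced by q ↦ ⟨ c , q ⟩.
module Submission where

open import Axiom.ExcludedMiddle using (ExcludedMiddle)
open import Data.Fin using (zero; suc; toℕ)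
open import Data.Fin.Properties using (toℕ<n)
open import Data.Nat using (ℕ; zero; suc; pred; _*_; _≤_; _<_; z≤n; s≤s; s<s⁻¹; ≢-nonZero)
open import Data.Nat.Properties
  using (*-suc; *-cancelˡ-≡; *-monoʳ-≤; ≤-refl; ≤-trans; ≤-reflexive; ≤-<-trans;
         m≤n⇒m≤1+n; m≤n⇒m<n∨m≡n; suc-injective; suc-pred; even≢odd)
open import Data.Product using (_×_; _,_; ∃; ∃-syntax; proj₁; proj₂)
open import Data.Sum using (_⊎_; inj₁; inj₂)
open import Data.Vec using (Vec; []; _∷_; lookup; tabulate)
open import Data.Vec.Properties using (lookup∘tabulate)
open import Function using (_∘_; _⇔_; mk⇔; Equivalence)
open import Level using (0ℓ)
open import Relation.Binary using (Rel; Setoid)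
open import Relation.Binary.PropositionalEquality
  using (_≡_; _≢_; _≗_; refl; sym; trans; cong; subst)
open import Relation.Nullary using (Dec; yes; no; ¬_; contradiction)
open import Defs

open PartialFun using (graph)
open Problem using (multiFun)

-- Functions computable from a fixed oracle

Recursive : Baire → ∀ {n} → (Vec ℕ n → ℕ) → Set
Recursive o {n} f = ∃[ e ] (∀ xs → o ⊢ e [ xs ]⇓ f xs)

Recursive₂ : Baire → (ℕ → ℕ → ℕ) → Set
Recursive₂ o f = ∃[ e ] (∀ x y → o ⊢ e [ x ∷ y ∷ [] ]⇓ f x y)

Recursive₃ : Baire → (ℕ → ℕ → ℕ → ℕ) → Set
Recursive₃ o f = ∃[ e ] (∀ x y z → o ⊢ e [ x ∷ y ∷ z ∷ [] ]⇓ f x y z)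

module _ {o : Baire} where

  -- The closure lemmas below build functions that read a vector through `lookup`; on a vector with
  -- explicit entries these reduce to ordinary functions.
  unary : ∀ {f} → Recursive o {1} (λ xs → f (lookup xs zero)) → f ≤T o
  unary (e , c) = e , λ x → c (x ∷ [])

  binary : ∀ {f} →
    Recursive o {2} (λ xs → f (lookup xs zero) (lookup xs (suc zero))) → Recursive₂ o f
  binary (e , c) = e , λ x y → c (x ∷ y ∷ [])

  ternary : ∀ {f} →
    Recursive o {3} (λ xs →
      f (lookup xs zero) (lookup xs (suc zero)) (lookup xs (suc (suc zero)))) →
    Recursive₃ o f
  ternary (e , c) = e , λ x y z → c (x ∷ y ∷ z ∷ [])

  recursive-proj : ∀ {n} i → Recursive o {n} (λ xs → lookup xs i)
  recursive-proj i = proj i , λ _ → ⇓proj i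

  recursive-zero : ∀ {n} → Recursive o {n} (λ _ → 0)
  recursive-zero = comp zer (λ ()) , λ _ → ⇓comp [] (λ ()) ⇓zer

  recursive-suc : suc ≤T o
  recursive-suc = succ , λ _ → ⇓succ

  recursive-comp₁ : ∀ {n h} {f : Vec ℕ n → ℕ} →
    h ≤T o → Recursive o f → Recursive o (λ xs → h (f xs))
  recursive-comp₁ {f = f} (d , ch) (e , cf) = comp d (λ _ → e) , λ xs →
    ⇓comp (f xs ∷ []) (λ { zero → cf xs }) (ch _)

  recursive-comp₂ : ∀ {n h} {f g : Vec ℕ n → ℕ} →
    Recursive₂ o h → Recursive o f → Recursive o g → Recursive o (λ xs → h (f xs) (g xs))
  recursive-comp₂ {f = f} {g} (d , ch) (e , cf) (e′ , cg) =
    comp d (λ { zero → e ; (suc _) → e′ }) , λ xs →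
    ⇓comp (f xs ∷ g xs ∷ []) (λ { zero → cf xs ; (suc zero) → cg xs }) (ch _ _)

  recursive-comp₃ : ∀ {n h} {f g k : Vec ℕ n → ℕ} →
    Recursive₃ o h → Recursive o f → Recursive o g → Recursive o k →
    Recursive o (λ xs → h (f xs) (g xs) (k xs))
  recursive-comp₃ {f = f} {g} {k} (d , ch) (e , cf) (e′ , cg) (e″ , ck) =
    comp d (λ { zero → e ; (suc zero) → e′ ; (suc (suc _)) → e″ }) , λ xs →
    ⇓comp (f xs ∷ g xs ∷ k xs ∷ [])
      (λ { zero → cf xs ; (suc zero) → cg xs ; (suc (suc zero)) → ck xs }) (ch _ _ _)

  -- `F` is fixed in advance and has to satisfy the recursion equations, which mostly hold by `refl`
  -- for functions defined by pattern matching.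
  recursive-prec : ∀ {n} {F : Vec ℕ (suc n) → ℕ} {b s} →
    Recursive o b → (∀ xs → b xs ≡ F (0 ∷ xs)) →
    Recursive o s → (∀ k xs → s (k ∷ F (k ∷ xs) ∷ xs) ≡ F (suc k ∷ xs)) →
    Recursive o F
  recursive-prec {F = F} (d , cb) F-zero (e , cs) F-suc =
    prec d e , λ { (k ∷ xs) → correct k xs }
    where
    correct : ∀ k xs → o ⊢ prec d e [ k ∷ xs ]⇓ F (k ∷ xs)
    correct zero    xs = subst (o ⊢ _ [ _ ]⇓_) (F-zero xs) (⇓prec0 (cb xs))
    correct (suc k) xs =
      subst (o ⊢ _ [ _ ]⇓_) (F-suc k xs) (⇓precS (correct k xs) (cs _))

-- The known zero `m` bounds the search: recursion on it, shifting `h` by one each time.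
least-zero : (h : ℕ → ℕ) → ∀ m → h m ≡ 0 →
  ∃[ k ] h k ≡ 0 × (∀ i → i < k → h i ≢ 0)
least-zero h zero    hm≡0 = zero , hm≡0 , λ _ ()
least-zero h (suc m) hm≡0 with h zero in h0≡
... | zero  = zero , h0≡ , λ _ ()
... | suc _ with least-zero (h ∘ suc) m hm≡0
...   | k , hk≡0 , below = suc k , hk≡0 , λ where
  zero    _   h0≡0 → contradiction (trans (sym h0≡) h0≡0) λ ()
  (suc i) i<k      → below i (s<s⁻¹ i<k)

recursive-mu : ∀ {o n} {h : Vec ℕ (suc n) → ℕ} → Recursive o h →
  (∀ xs → ∃[ m ] h (m ∷ xs) ≡ 0) →
  ∃[ μ ] Recursive o μ × (∀ xs → h (μ xs ∷ xs) ≡ 0)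
recursive-mu {o} {n} {h} (e , ch) bound =
  (λ xs → proj₁ (least xs)) ,
  (mu e , λ xs → let (k , hk≡0 , below) = least xs in
    -- `⇓mu` records each value below the zero as a successor; these values are nonzero, so `pred`
    -- loses nothing.
    ⇓mu (tabulate {n = k} (λ i → pred (h (toℕ i ∷ xs))))
      (λ i → subst (o ⊢ e [ toℕ i ∷ xs ]⇓_)
        (trans (sym (suc-pred _ {{≢-nonZero (below (toℕ i) (toℕ<n i))}}))
               (cong suc (sym (lookup∘tabulate (λ j → pred (h (toℕ j ∷ xs))) i))))
        (ch _))
      (subst (o ⊢ e [ k ∷ xs ]⇓_) hk≡0 (ch _))) ,
  λ xs → proj₁ (proj₂ (least xs))
  where
  least : ∀ xs → ∃[ k ] h (k ∷ xs) ≡ 0 × (∀ i → i < k → h (i ∷ xs) ≢ 0)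
  least xs = least-zero (λ k → h (k ∷ xs)) (proj₁ (bound xs)) (proj₂ (bound xs))

recursive-double : ∀ {o} → (2 *_) ≤T o
recursive-double = unary (recursive-prec
  recursive-zero (λ _ → refl)
  (recursive-comp₁ recursive-suc (recursive-comp₁ recursive-suc (recursive-proj (suc zero))))
  (λ k _ → sym (*-suc 2 k)))

-- Joins

≤T-joinˡ : ∀ {p q} → p ≤T ⟨ p , q ⟩
≤T-joinˡ {p} {q} = ≤T-trans (≤T-reflexive (sym ∘ ⟨,⟩-even p q))
  (unary (recursive-comp₁ ≤T-refl (recursive-comp₁ recursive-double (recursive-proj zero))))

≤T-joinʳ : ∀ {p q} → q ≤T ⟨ p , q ⟩
≤T-joinʳ {p} {q} = ≤T-trans (≤T-reflexive (sym ∘ ⟨,⟩-odd p q))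
  (unary (recursive-comp₁ ≤T-refl
    (recursive-comp₁ recursive-suc (recursive-comp₁ recursive-double (recursive-proj zero)))))

ifZero : ℕ → ℕ → ℕ → ℕ
ifZero zero    x y = x
ifZero (suc _) x y = y

parity : ℕ → ℕ
parity zero    = 0
parity (suc n) = ifZero (parity n) 1 0

half : ℕ → ℕ
half zero    = 0
half (suc n) = ifZero (parity n) (half n) (suc (half n))

-- The recursion of the join swaps its arguments as the parity flips. The shifted `p` is read
-- exactly for odd `n`, where `half (suc n)` exceeds `half n`.
⟨,⟩-ifZero : ∀ p q n → ifZero (parity n) (p (half n)) (q (half n)) ≡ ⟨ p , q ⟩ n
⟨,⟩-ifZero p q zero = refl
⟨,⟩-ifZero p q (suc n) with parity n | ⟨,⟩-ifZero q (p ∘ suc) n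
... | zero  | eq = eq
... | suc _ | eq = eq

module _ {o : Baire} where

  recursive-ifZero : Recursive₃ o ifZero
  recursive-ifZero = ternary (recursive-prec
    (recursive-proj zero) (λ _ → refl)
    (recursive-proj (suc (suc (suc zero)))) (λ _ _ → refl))

  recursive-parity : parity ≤T o
  recursive-parity = unary (recursive-prec
    recursive-zero (λ _ → refl)
    (recursive-comp₃ recursive-ifZero (recursive-proj (suc zero))
      (recursive-comp₁ recursive-suc recursive-zero) recursive-zero)
    (λ _ _ → refl))

  recursive-half : half ≤T o
  recursive-half = unary (recursive-prec
    recursive-zero (λ _ → refl)
    (recursive-comp₃ recursive-ifZero
      (recursive-comp₁ recursive-parity (recursive-proj zero))
      (recursive-proj (suc zero))
      (recursive-comp₁ recursive-suc (recursive-proj (suc zero))))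
    (λ _ _ → refl))

  ≤T-join : ∀ {p q} → p ≤T o → q ≤T o → ⟨ p , q ⟩ ≤T o
  ≤T-join {p} {q} p≤o q≤o = ≤T-trans (≤T-reflexive (sym ∘ ⟨,⟩-ifZero p q))
    (unary (recursive-comp₃ recursive-ifZero
      (recursive-comp₁ recursive-parity (recursive-proj zero))
      (recursive-comp₁ p≤o (recursive-comp₁ recursive-half (recursive-proj zero)))
      (recursive-comp₁ q≤o (recursive-comp₁ recursive-half (recursive-proj zero)))))

≤T-join-monoʳ : ∀ {p q r} → q ≤T r → ⟨ p , q ⟩ ≤T ⟨ p , r ⟩
≤T-join-monoʳ q≤r = ≤T-join ≤T-joinˡ (≤T-trans q≤r ≤T-joinʳ)

-- Codes of finite prefixes

-- pair x y = 2ˣ (2y + 1)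
pair : ℕ → ℕ → ℕ
pair zero    y = suc (2 * y)
pair (suc x) y = 2 * pair x y

pair-injective : ∀ x x′ {y y′} → pair x y ≡ pair x′ y′ → x ≡ x′ × y ≡ y′
pair-injective zero zero eq = refl , *-cancelˡ-≡ _ _ 2 (suc-injective eq)
pair-injective zero (suc x′) {y} {y′} eq = contradiction (sym eq) (even≢odd (pair x′ y′) y)
pair-injective (suc x) zero {y} {y′} eq = contradiction eq (even≢odd (pair x y) y′)
pair-injective (suc x) (suc x′) eq with pair-injective x x′ (*-cancelˡ-≡ _ _ 2 eq)
... | x≡x′ , y≡y′ = cong suc x≡x′ , y≡y′

prefix : Baire → ℕ → ℕ → ℕ
prefix p zero    n = n
prefix p (suc m) n = pair (p m) (prefix p m n)

prefix-injective : ∀ p p′ m {n n′} →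
  prefix p m n ≡ prefix p′ m n′ → Agree m p p′ × n ≡ n′
prefix-injective p p′ zero    eq = (λ _ ()) , eq
prefix-injective p p′ (suc m) eq with pair-injective (p m) (p′ m) eq
... | pm≡p′m , eq′ with prefix-injective p p′ m eq′
...   | agree , n≡n′ = agree′ , n≡n′
  where
  agree′ : Agree (suc m) p p′
  agree′ i (s≤s i≤m) with m≤n⇒m<n∨m≡n i≤m
  ... | inj₁ i<m  = agree i i<m
  ... | inj₂ refl = pm≡p′m

-- `prefix` does not record its length and may end in any `n`; with `m` in front, the prefix and the
-- position asked for can both be recovered.
key : Baire → ℕ → ℕ → ℕ
key p m n = pair m (prefix p m n)

key-injective : ∀ p p′ m m′ {n n′} →
  key p m n ≡ key p′ m′ n′ → m ≡ m′ × Agree m p p′ × n ≡ n′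
key-injective p p′ m m′ eq with pair-injective m m′ eq
... | refl , eq′ = refl , prefix-injective p p′ m eq′

module _ {o : Baire} where

  recursive-pair : Recursive₂ o pair
  recursive-pair = binary (recursive-prec
    (recursive-comp₁ recursive-suc (recursive-comp₁ recursive-double (recursive-proj zero)))
    (λ _ → refl)
    (recursive-comp₁ recursive-double (recursive-proj (suc zero))) (λ _ _ → refl))

  recursive-prefix : ∀ {p} → p ≤T o → Recursive₂ o (prefix p)
  recursive-prefix p≤o = binary (recursive-prec
    (recursive-proj zero) (λ _ → refl)
    (recursive-comp₂ recursive-pair
      (recursive-comp₁ p≤o (recursive-proj zero)) (recursive-proj (suc zero)))
    (λ _ _ → refl))

  recursive-key : ∀ {p} → p ≤T o → Recursive₂ o (key p)
  recursive-key p≤o = binary (recursive-comp₂ recursive-pair (recursive-proj zero)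
    (recursive-comp₂ (recursive-prefix p≤o) (recursive-proj zero) (recursive-proj (suc zero))))

-- Total functions on Baire space

total : (F : Baire → Baire) → (∀ {p p′} → p ≗ p′ → F p ≗ F p′) → PartialFun
total F F-cong = record
  { graph      = λ p q → q ≗ F p
  ; resp       = λ p≗ q≗ e n → trans (sym (q≗ n)) (trans (e n) (F-cong p≗ n))
  ; functional = λ e e′ n → trans (e n) (sym (e′ n))
  }

idₚ : PartialFun
idₚ = total (λ p → p) (λ e → e)

sndₚ : PartialFun
sndₚ = total (λ p n → p (suc (2 * n))) (λ e n → e (suc (2 * n)))

computable-id : Computable idₚ
computable-id = oracle , λ e → proj₂ (≤T-reflexive e)

-- The program is the same for all oracles, so any oracle will do to extract it.
computable-snd : Computable sndₚ
computable-snd = proj₁ (program (λ _ → 0)) , λ {p} {q} e n →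
  subst (p ⊢ _ [ _ ]⇓_) (sym (e n)) (proj₂ (program p) n)
  where
  program : ∀ p → (λ n → p (suc (2 * n))) ≤T p
  program p = unary (recursive-comp₁ ≤T-refl
    (recursive-comp₁ recursive-suc (recursive-comp₁ recursive-double (recursive-proj zero))))

modulus⇒continuous : ∀ {F} (F-cong : ∀ {p p′} → p ≗ p′ → F p ≗ F p′) →
  (∀ n → ∃[ m ] (∀ {p p′} → Agree m p p′ → Agree n (F p) (F p′))) →
  Continuous (total F F-cong)
modulus⇒continuous _ modulus e n = let (m , mod) = modulus n in
  m , λ e′ agree i i<n → trans (e i) (trans (mod agree i i<n) (sym (e′ i)))

continuous-id : Continuous idₚ
continuous-id = modulus⇒continuous (λ e → e) λ n → n , λ agree → agree

continuous-snd : Continuous sndₚ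
continuous-snd = modulus⇒continuous (λ e n → e (suc (2 * n))) λ n → 2 * n , λ agree i i<n →
  agree (suc (2 * i)) (≤-trans (≤-reflexive (sym (*-suc 2 i))) (*-monoʳ-≤ 2 i<n))

joinₚ : Baire → PartialFun
joinₚ c = total ⟨ c ,_⟩ (⟨,⟩-cong (λ _ → refl))

⟨,⟩-local : ∀ {p p′ q q′} n →
  (∀ i → i ≤ n → p i ≡ p′ i) → (∀ i → i ≤ n → q i ≡ q′ i) →
  ⟨ p , q ⟩ n ≡ ⟨ p′ , q′ ⟩ n
⟨,⟩-local zero    p≡ q≡ = p≡ 0 z≤n
⟨,⟩-local (suc n) p≡ q≡ = ⟨,⟩-local n
  (λ i i≤n → q≡ i (m≤n⇒m≤1+n i≤n)) (λ i i≤n → p≡ (suc i) (s≤s i≤n))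

continuous-join : ∀ c → Continuous (joinₚ c)
continuous-join c = modulus⇒continuous (⟨,⟩-cong (λ _ → refl)) λ n → n , λ agree i i<n →
  ⟨,⟩-local i (λ _ _ → refl) (λ j j≤i → agree j (≤-<-trans j≤i i<n))

-- An answer `q` to a cone query merely computes some suitable name, so `H` may be undefined on it.
-- `H′` must be defined there, and its single output `q′` must lie above the images of all `r` below
-- `q`.
Dominated : (PartialFun → Set) → PartialFun → Set₁
Dominated C H = ∃[ H′ ] C H′ ×
  (∀ q → ∃[ q′ ] graph H′ q q′ × (∀ {r s} → graph H r s → r ≤T q → s ≤T q′))

computable-dominated : ∀ H → Computable H → Dominated Computable H
computable-dominated _ (e , c) = idₚ , computable-id , λ q →
  q , (λ _ → refl) , λ Hrs r≤q → ≤T-trans (e , c Hrs) r≤q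

interior-⇔ : ∀ {a ℓ} {A : Set a} {_≤₁_ _≤₂_ : Rel A ℓ} {op : A → A} →
  (∀ x y → x ≤₁ y ⇔ x ≤₂ y) → InteriorOperator _≤₂_ op → InteriorOperator _≤₁_ op
interior-⇔ eqv (deflationary , monotone , idempotent) =
  (λ x → from (deflationary x)) ,
  (λ x y x≤y → from (monotone x y (to x≤y))) ,
  (λ x → from (idempotent x))
  where
  open module E {x} {y} = Equivalence (eqv x y)

-- Continuous functions as functions computable relative to an oracle

module _ (em : ExcludedMiddle 0ℓ) where

  module _ (H : PartialFun) (H-cont : Continuous H) where

    -- k codes a prefix that forces the n-th value of H to be v on all of its extensions.
    Forces : ℕ → ℕ → Set
    Forces k v = ∃[ p ] ∃[ m ] ∃[ n ] key p m n ≡ k ×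
      (∀ {p′ q′} → graph H p′ q′ → Agree m p p′ → v ≡ q′ n)

    -- The point inside `Forces` may differ from `r`, but by injectivity of keys it agrees with `r`
    -- up to `m`, so `r` is among the extensions quantified over. A prefix with no extension in the
    -- domain forces every value, but a prefix of `r` is never of this kind.
    forces-sound : ∀ {r s} → graph H r s → ∀ m n {v} → Forces (key r m n) v → v ≡ s n
    forces-sound {r} Hrs m n (p , m′ , n′ , eq , forced)
      with key-injective p r m′ m eq
    ... | refl , agree , refl = forced Hrs agree

    forces-complete : ∀ {r s} → graph H r s → ∀ n → ∃[ m ] Forces (key r m n) (s n)
    -- `Agree` bounds indices strictly, so position `n` takes precision `suc n`.
    forces-complete {r} Hrs n = let (m , mod) = H-cont Hrs (suc n) in
      m , r , m , n , refl , λ Hp′q′ agree → mod Hp′q′ agree n ≤-refl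

    -- Forcing quantifies over the whole graph of `H`; excluded middle turns it into total
    -- functions, possibly uncomputable, that can serve as an oracle.
    decide : ∀ k → Dec (∃ (Forces k))
    decide k = em

    -- Yes is 0 because `mu` looks for zeros. The 0 of `value` is a default for keys that force
    -- nothing.
    flag value : ℕ → ℕ
    flag k with decide k
    ... | yes _ = 0
    ... | no  _ = 1
    value k with decide k
    ... | yes (v , _) = v
    ... | no  _       = 0

    flag-zero : ∀ {k v} → Forces k v → flag k ≡ 0
    flag-zero {k} kv with decide k
    ... | yes _ = refl
    ... | no ¬k = contradiction (_ , kv) ¬k

    value-forced : ∀ {k} → flag k ≡ 0 → Forces k (value k)
    value-forced {k} _ with decide k
    value-forced {k} _  | yes (_ , kv) = kv
    value-forced {k} () | no _

    -- To compute `s n`, search for the first prefix of `r` that forces a value at `n` and look that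
    -- value up. Continuity at `r` makes the search end.
    ≤T-continuous : ∀ {r s o} → graph H r s →
      flag ≤T o → value ≤T o → r ≤T o → s ≤T o
    ≤T-continuous {r} {s} {o} Hrs flag≤o value≤o r≤o =
      ≤T-trans (≤T-reflexive correct) (unary (recursive-comp₁ value≤o
        (recursive-comp₂ (recursive-key r≤o) recursive-μ (recursive-proj zero))))
      where
      search : ∃[ μ ] Recursive o {1} μ × (∀ xs → flag (key r (μ xs) (lookup xs zero)) ≡ 0)
      search = recursive-mu
        (recursive-comp₁ flag≤o
          (recursive-comp₂ (recursive-key r≤o) (recursive-proj zero) (recursive-proj (suc zero))))
        λ xs → let (m , forces) = forces-complete Hrs (lookup xs zero) in
          m , flag-zero forces

      μ : ℕ → ℕ
      μ n = proj₁ search (n ∷ [])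

      recursive-μ : Recursive o {1} (λ xs → μ (lookup xs zero))
      recursive-μ = let (_ , (e , c) , _) = search in e , λ { (n ∷ []) → c (n ∷ []) }

      correct : ∀ n → s n ≡ value (key r (μ n) n)
      correct n = sym (forces-sound Hrs (μ n) n
        (value-forced (proj₂ (proj₂ search) (n ∷ []))))

    continuous-dominated : Dominated Continuous H
    continuous-dominated = joinₚ ⟨ flag , value ⟩ , continuous-join _ , λ q →
      ⟨ ⟨ flag , value ⟩ , q ⟩ , (λ _ → refl) , λ Hrs r≤q → ≤T-continuous Hrs
        (≤T-trans ≤T-joinˡ ≤T-joinˡ) (≤T-trans ≤T-joinʳ ≤T-joinˡ) (≤T-trans r≤q ≤T-joinʳ)

-- Modifying realizers

module _ (g : MultiFun) where
  open MultiFun g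

  -- A reduction to g works for realizers with this minimal domain, so K p is a name of a
  -- point of dom g.
  restrict : PartialFun → PartialFun
  restrict F = record
    { graph      = λ p q → graph F p q × ∃[ x ] S.δ p x × dom x
    ; resp       = λ { p≗ q≗ (Fpq , x , δpx , x∈dom) →
        F.resp p≗ q≗ Fpq , x , S.δ-resp p≗ (Setoid.refl S.setoid) δpx , x∈dom }
    ; functional = λ (Fpq , _) (Fpq′ , _) → F.functional Fpq Fpq′
    }
    where module F = PartialFun F

  restrict-realizes : ∀ {F} → F Realizes g → restrict F Realizes g
  restrict-realizes Fr δpx x∈dom = let (q , Fpq , y∈) = Fr δpx x∈dom in
    q , (Fpq , _ , δpx , x∈dom) , y∈

  -- Realizers may treat names of the same point differently, so a realizer can be given any
  -- legitimate answer `b` at the single name `a`.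
  redirect : Baire → Baire → PartialFun → PartialFun
  redirect a b F = record
    { graph      = λ p q → (p ≗ a × q ≗ b) ⊎ (¬ p ≗ a × graph F p q)
    ; resp       = λ where
        p≗ q≗ (inj₁ (p≗a , q≗b)) →
          inj₁ ((λ n → trans (sym (p≗ n)) (p≗a n)) , (λ n → trans (sym (q≗ n)) (q≗b n)))
        p≗ q≗ (inj₂ (p≗̸a , Fpq)) →
          inj₂ ((λ p′≗a → p≗̸a (λ n → trans (p≗ n) (p′≗a n))) , F.resp p≗ q≗ Fpq)
    ; functional = λ where
        (inj₁ (_ , q≗b)) (inj₁ (_ , q′≗b)) n → trans (q≗b n) (sym (q′≗b n))
        (inj₁ (p≗a , _)) (inj₂ (p≗̸a , _))   → contradiction p≗a p≗̸a
        (inj₂ (p≗̸a , _)) (inj₁ (p≗a , _))   → contradiction p≗a p≗̸a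
        (inj₂ (_ , Fpq)) (inj₂ (_ , Fpq′))   → F.functional Fpq Fpq′
    }
    where module F = PartialFun F

  redirect-realizes : ExcludedMiddle 0ℓ → ∀ {F a b x y} → F Realizes g →
    S.δ a x → T.δ b y → rel x y → redirect a b F Realizes g
  redirect-realizes em {a = a} {b} {y = y} Fr δax δby xy {p} δpx′ x′∈dom with em {P = p ≗ a}
  -- The point named by `p` is then the one named by `a`, so `y` is a value there too.
  ... | yes p≗a = b , inj₁ (p≗a , λ _ → refl) , y , δby ,
    resp (S.δ-functional δax (S.δ-resp p≗a (Setoid.refl S.setoid) δpx′))
      (Setoid.refl T.setoid) xy
  ... | no p≗̸a = let (q , Fpq , y∈) = Fr δpx′ x′∈dom in q , inj₂ (p≗̸a , Fpq) , y∈

-- In a weak reduction H is applied to ⟨ p , b ⟩ and in a strong one to b, where b is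
-- the answer to K p; combine p b stands for either.
ReductionVia : (Baire → Baire → Baire) → (PartialFun → Set) → Rel Problem _
ReductionVia combine C f g = ∃[ H ] ∃[ K ] C H × C K ×
  (∀ G → G Realizes multiFun g → ∀ {p x} → S.δ p x → dom x →
    ∃[ a ] ∃[ b ] ∃[ s ] graph K p a × graph G a b × graph H (combine p b) s ×
      (∃[ y ] T.δ s y × rel x y))
  where open Problem f

strong⇔via : ∀ {C} f g → StrongReduction C f g ⇔ ReductionVia (λ _ b → b) C f g
strong⇔via f g = mk⇔
  (λ (H , K , CH , CK , red) → H , K , CH , CK , λ G Gr δpx x∈dom →
    let (s , (b , (a , Kpa , Gab) , Hbs) , y∈) = red G Gr δpx x∈dom in
    a , b , s , Kpa , Gab , Hbs , y∈)
  (λ (H , K , CH , CK , red) → H , K , CH , CK , λ G Gr δpx x∈dom →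
    let (a , b , s , Kpa , Gab , Hbs , y∈) = red G Gr δpx x∈dom in
    s , (b , (a , Kpa , Gab) , Hbs) , y∈)

weak⇔via : ∀ {C} f g → Reduction C f g ⇔ ReductionVia ⟨_,_⟩ C f g
weak⇔via f g = mk⇔
  (λ (H , K , CH , CK , red) → H , K , CH , CK , λ G Gr δpx x∈dom →
    let (s , (u , (b , (a , Kpa , Gab) , u≗) , Hus) , y∈) = red G Gr δpx x∈dom in
    a , b , s , Kpa , Gab , PartialFun.resp H u≗ (λ _ → refl) Hus , y∈)
  (λ (H , K , CH , CK , red) → H , K , CH , CK , λ G Gr δpx x∈dom →
    let (a , b , s , Kpa , Gab , Hbs , y∈) = red G Gr δpx x∈dom in
    s , (_ , (b , (a , Kpa , Gab) , λ _ → refl) , Hbs) , y∈)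

-- The three laws of an interior operator

module _ (em : ExcludedMiddle 0ℓ) where

  module _ {C : PartialFun → Set} {combine : Baire → Baire → Baire}
           (combine-cong : ∀ {p b b′} → b ≗ b′ → combine p b ≗ combine p b′)
           (combine-mono : ∀ {p b q} → b ≤T q → combine p b ≤T combine p q)
           (C-id : C idₚ) (answer : PartialFun) (C-answer : C answer)
           (answer-combine : ∀ p b → graph answer (combine p b) b)
           (dominated : ∀ H → C H → Dominated C H) where

    realizers⊆⇒via : ∀ {f g} →
      (∀ G → G Realizes multiFun g → G Realizes multiFun f) → ReductionVia combine C f g
    realizers⊆⇒via realizes = answer , idₚ , C-answer , C-id , λ G Gr {p} δpx x∈dom →
      let (q , Gpq , y∈) = realizes G Gr δpx x∈dom in
      p , q , q , (λ _ → refl) , Gpq , answer-combine p q , y∈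

    -- The given reduction is run on two modifications of a realizer `F` of `g`, to analyse what `G`
    -- answers; `H′` and `K` are chosen independently of `G`.
    cone-via-mono : ∀ {f g} → ReductionVia combine C f g → ReductionVia combine C (f ᴰ) (g ᴰ)
    cone-via-mono {f} {g} (H , K , CH , CK , red) =
      let (H′ , CH′ , dominates) = dominated H CH
          (F , Fr) = g.hasRealizer
      in H′ , K , CH′ , CK , λ G Gr {p} {x} δpx x∈domᴰ →
      let x∈dom = Equivalence.to (dom-cone f.multiFun x) x∈domᴰ
          -- The first run only shows that `K` maps `p` to a name `a` of a point in the domain of
          -- `g`, where `G` must answer.
          (a , _ , _ , Kpa , (_ , x′ , δax′ , x′∈dom) , _) =
            red (restrict g.multiFun F) (restrict-realizes g.multiFun {F} Fr) δpx x∈dom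
          (q , Gaq , d , q≈d , q₁ , d≈q₁ , y , (b , δby , b≤q₁) , x′y) =
            Gr δax′ (Equivalence.from (dom-cone g.multiFun x′) x′∈dom)
          b≤q = ≤T-trans b≤q₁ (proj₂ (≈D.trans {deg q} {d} {deg q₁} q≈d d≈q₁))
          -- In the second run the answer at `a` is the name `b` computed by the answer of `G`.
          (a′ , b′ , s , Kpa′ , b′-answer , Hb′s , z , δsz , xz) =
            red (redirect g.multiFun a b F)
              (redirect-realizes g.multiFun em {F} Fr δax′ δby x′y) δpx x∈dom
          -- Both runs evaluate `K` at `p`, so `a′` agrees with `a` and the redirected branch
          -- applies.
          b′≗b = redirected F a b (PartialFun.functional K Kpa′ Kpa) b′-answer
          Hbs = PartialFun.resp H (combine-cong b′≗b) (λ _ → refl) Hb′s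
          (q′ , H′qq′ , below) = dominates (combine p q)
      in a , q , q′ , Kpa , Gaq , H′qq′ ,
         deg q′ , ≈D.refl {deg q′} , q′ , ≈D.refl {deg q′} ,
         z , (s , δsz , below Hbs (combine-mono b≤q)) , xz
      where
      module f = Problem f
      module g = Problem g

      redirected : ∀ F a b {a′ b′} → a′ ≗ a → graph (redirect g.multiFun a b F) a′ b′ → b′ ≗ b
      redirected F a b a′≗a (inj₁ (_ , b′≗b)) = b′≗b
      redirected F a b a′≗a (inj₂ (a′≗̸a , _)) = contradiction a′≗a a′≗̸a

    interior-via : InteriorOperator (ReductionVia combine C) _ᴰ
    interior-via =
      (λ f → realizers⊆⇒via {f ᴰ} {f} λ G Gr → realizes-cone f G Gr) ,
      (λ f g → cone-via-mono {f} {g}) ,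
      (λ f → realizers⊆⇒via {f ᴰ} {f ᴰ ᴰ} λ G Gr → realizes-coneᴰ f G Gr)
      where
      realizes-cone : ∀ f G → G Realizes multiFun f → G Realizes multiFun (f ᴰ)
      realizes-cone f G Gr {x = x} δpx x∈dom =
        let (q , Gpq , y , δqy , xy) =
              Gr δpx (Equivalence.to (dom-cone (multiFun f) x) x∈dom)
        in q , Gpq , deg q , ≈D.refl {deg q} ,
           q , ≈D.refl {deg q} , y , (q , δqy , ≤T-refl) , xy

      realizes-coneᴰ : ∀ f G → G Realizes multiFun (f ᴰ ᴰ) → G Realizes multiFun (f ᴰ)
      realizes-coneᴰ f G Gr {x = x} δpx x∈dom =
        let (q , Gpq , d , (_ , d≤q) , q₁ , (_ , q₁≤d) ,
             d₁ , (r , (_ , d₁≤r) , r≤q₁) , q₂ , (_ , q₂≤d₁) , y , (t , δty , t≤q₂) , xy) =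
              Gr δpx (Equivalence.from (dom-cone (multiFun (f ᴰ)) x) x∈dom)
            -- Names of a degree are its members, so computing a name of `d₁` means lying above
            -- `d₁`, and the two nested cones collapse by transitivity.
            q₂≤q = ≤T-trans q₂≤d₁ (≤T-trans d₁≤r (≤T-trans r≤q₁ (≤T-trans q₁≤d d≤q)))
        in q , Gpq , deg q , ≈D.refl {deg q} ,
           q , ≈D.refl {deg q} , y , (t , δty , ≤T-trans t≤q₂ q₂≤q) , xy

  module _ {C : PartialFun → Set}
           (C-id : C idₚ) (C-snd : C sndₚ) (dominated : ∀ H → C H → Dominated C H) where

    interior-strong : InteriorOperator (StrongReduction C) _ᴰ
    interior-strong = interior-⇔ {op = _ᴰ} strong⇔via
      (interior-via (λ e → e) (λ b≤q → b≤q) C-id idₚ C-id (λ _ _ _ → refl) dominated)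

    interior-weak : InteriorOperator (Reduction C) _ᴰ
    interior-weak = interior-⇔ {op = _ᴰ} weak⇔via
      (interior-via (⟨,⟩-cong (λ _ → refl)) ≤T-join-monoʳ C-id sndₚ C-snd
        (λ p b n → sym (⟨,⟩-odd p b n)) dominated)

proposition4p4 : ExcludedMiddle 0ℓ →
    InteriorOperator _≤sW_ _ᴰ ×
    InteriorOperator _≤W_ _ᴰ ×
    InteriorOperator _≤W*_ _ᴰ ×
    InteriorOperator _≤sW*_ _ᴰ
proposition4p4 em =
  interior-strong em {Computable} computable-id computable-snd computable-dominated ,
  interior-weak em {Computable} computable-id computable-snd computable-dominated ,
  interior-weak em {Continuous} continuous-id continuous-snd (continuous-dominated em) ,
  interior-strong em {Continuous} continuous-id continuous-snd (continuous-dominated em)
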